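{- There exists an absolute constant $C>0$ such that for every integer $n \geq 1$ and all integers $a,b,c$ with $1 \leq a,b,c \leq n$: if $\sqrt{a}+\sqrt{b}+\sqrt{c}$ is not an integer, then $$ \left\| \sqrt{a}+\sqrt{b}+\sqrt{c} \right\| \geq \frac{C}{n^{7/2}}.$$
   Context: For a real number $x$, $\|x\| = \min_{m \in \mathbb{Z}} |x-m|$ denotes the distance from $x$ to the nearest integer. -}

module Defs where

open import Data.Integer.Base as ℤ using (ℤ; +_; -[1+_]; 0ℤ; 1ℤ)
import Data.Integer.DivMod as ℤ
import Data.Integer.Properties as ℤ
open import Data.Nat.Base as ℕ using (ℕ; zero; suc; _^_)
import Data.Nat.Coprimality as ℕ
import Data.Nat.Properties as ℕ
open import Data.Product using (∃-syntax; _×_; _,_; proj₁; proj₂)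
open import Data.Rational.Base as ℚ using (ℚ; mkℚ; 0ℚ; 1ℚ; ½)
import Data.Rational.Properties as ℚ
import Data.Rational.Unnormalised.Base as ℚᵘ
import Data.Rational.Unnormalised.Properties as ℚᵘ
open import Data.Rational.Solver using (module +-*-Solver)
open import Data.Sum.Base using (inj₁; inj₂)
open import Relation.Binary.PropositionalEquality
  using (_≡_; refl; sym; trans; cong; cong₂; subst; subst₂)
open import Relation.Nullary using (yes; no; contradiction)

module Rational where
  open import Data.Rational.Base
  open ℚ.≤-Reasoning
  open +-*-Solver

  0≤q-p⇒p≤q : ∀ {p q} → 0ℚ ≤ q - p → p ≤ q
  0≤q-p⇒p≤q {p} {q} h = begin
    p            ≡⟨ ℚ.+-identityʳ p ⟨
    p + 0ℚ       ≤⟨ ℚ.+-monoʳ-≤ p h ⟩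
    p + (q - p)  ≡⟨ solve 2 (λ p q → p :+ (q :- p) := q) refl p q ⟩
    q            ∎

  p≤q⇒0≤q-p : ∀ {p q} → p ≤ q → 0ℚ ≤ q - p
  p≤q⇒0≤q-p {p} {q} h = begin
    0ℚ      ≡⟨ ℚ.+-inverseʳ p ⟨
    p - p   ≤⟨ ℚ.+-monoˡ-≤ (- p) h ⟩
    q - p   ∎

  *-mono-≤-nonNeg : ∀ {p q r s} → 0ℚ ≤ p → 0ℚ ≤ s → p ≤ q → r ≤ s → p * r ≤ q * s
  *-mono-≤-nonNeg {p} {q} {r} {s} 0≤p 0≤s p≤q r≤s = begin
    p * r ≤⟨ ℚ.*-monoˡ-≤-nonNeg p {{nonNegative 0≤p}} r≤s ⟩
    p * s ≤⟨ ℚ.*-monoʳ-≤-nonNeg s {{nonNegative 0≤s}} p≤q ⟩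
    q * s ∎

  0≤p*q : ∀ {p q} → 0ℚ ≤ p → 0ℚ ≤ q → 0ℚ ≤ p * q
  0≤p*q 0≤p 0≤q = *-mono-≤-nonNeg ℚ.≤-refl 0≤q 0≤p 0≤q

  0<p*q : ∀ {p q} → 0ℚ < p → 0ℚ < q → 0ℚ < p * q
  0<p*q {p} {q} 0<p 0<q =
    ℚ.positive⁻¹ (p * q) {{ℚ.pos*pos⇒pos p {{positive 0<p}} q {{positive 0<q}}}}

  0≤1 : 0ℚ ≤ 1ℚ
  0≤1 = ℚ.nonNegative⁻¹ 1ℚ

  0<1 : 0ℚ < 1ℚ
  0<1 = ℚ.positive⁻¹ 1ℚ

  0<½ : 0ℚ < ½
  0<½ = ℚ.positive⁻¹ ½

  half : ℚ → ℚ
  half ε = ½ * ε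

  half-pos : ∀ {ε} → 0ℚ < ε → 0ℚ < half ε
  half-pos = 0<p*q 0<½

  half+half : ∀ ε → half ε + half ε ≡ ε
  half+half ε = trans (sym (ℚ.*-distribʳ-+ ε ½ ½)) (ℚ.*-identityˡ ε)

  -- Total, with recip 0ℚ = 0ℚ, so that the inverse of a positive real can be
  -- taken termwise: only finitely many terms of its sequence can be nonpositive.
  recip : ℚ → ℚ
  recip p with p ℚ.≟ 0ℚ
  ... | yes _  = 0ℚ
  ... | no p≢0 = (1/ p) {{≢-nonZero p≢0}}

  *-recip : ∀ {p} → 0ℚ < p → p * recip p ≡ 1ℚ
  *-recip {p} 0<p with p ℚ.≟ 0ℚ
  ... | yes p≡0 = contradiction (sym p≡0) (ℚ.<⇒≢ 0<p)
  ... | no p≢0  = ℚ.*-inverseʳ p {{≢-nonZero p≢0}}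

  recip-pos : ∀ {p} → 0ℚ < p → 0ℚ < recip p
  recip-pos {p} 0<p = ℚ.*-cancelˡ-<-nonNeg p {{nonNegative (ℚ.<⇒≤ 0<p)}}
    (subst₂ _<_ (sym (ℚ.*-zeroʳ p)) (sym (*-recip 0<p)) 0<1)

  recip-antimono : ∀ {p q} → 0ℚ < p → p ≤ q → recip q ≤ recip p
  recip-antimono {p} {q} 0<p p≤q = begin
    recip q                   ≡⟨ ℚ.*-identityʳ (recip q) ⟨
    recip q * 1ℚ              ≡⟨ cong (recip q *_) (*-recip 0<p) ⟨
    recip q * (p * recip p)   ≤⟨ *-mono-≤-nonNeg (ℚ.<⇒≤ (recip-pos 0<q))
                                   (0≤p*q (ℚ.<⇒≤ 0<q) (ℚ.<⇒≤ (recip-pos 0<p))) ℚ.≤-refl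
                                   (ℚ.*-monoʳ-≤-nonNeg (recip p)
                                     {{nonNegative (ℚ.<⇒≤ (recip-pos 0<p))}} p≤q) ⟩
    recip q * (q * recip p)   ≡⟨ solve 3 (λ a b c → a :* (b :* c) := (b :* a) :* c) refl
                                   (recip q) q (recip p) ⟩
    (q * recip q) * recip p   ≡⟨ cong (_* recip p) (*-recip 0<q) ⟩
    1ℚ * recip p              ≡⟨ ℚ.*-identityˡ (recip p) ⟩
    recip p                   ∎
    where
    0<q : 0ℚ < q
    0<q = ℚ.<-≤-trans 0<p p≤q

  divide : ∀ {b ε} → 0ℚ < b → 0ℚ < ε → ∃[ δ ] 0ℚ < δ × b * δ ≡ ε
  divide {b} {ε} 0<b 0<ε = recip b * ε , 0<p*q (recip-pos 0<b) 0<ε ,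
    trans (sym (ℚ.*-assoc b (recip b) ε))
          (trans (cong (_* ε) (*-recip 0<b)) (ℚ.*-identityˡ ε))

  ∣p∣≤q : ∀ {p q} → p ≤ q → - p ≤ q → ∣ p ∣ ≤ q
  ∣p∣≤q {p} {q} h₁ h₂ with ℚ.∣p∣≡p∨∣p∣≡-p p
  ... | inj₁ e = subst (_≤ q) (sym e) h₁
  ... | inj₂ e = subst (_≤ q) (sym e) h₂

  p≤∣p∣ : ∀ p → p ≤ ∣ p ∣
  p≤∣p∣ p with ℚ.≤-total 0ℚ p
  ... | inj₁ 0≤p = ℚ.≤-reflexive (sym (ℚ.0≤p⇒∣p∣≡p 0≤p))
  ... | inj₂ p≤0 = ℚ.≤-trans p≤0 (ℚ.0≤∣p∣ p)

  ∣p-q∣≡∣q-p∣ : ∀ p q → ∣ p - q ∣ ≡ ∣ q - p ∣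
  ∣p-q∣≡∣q-p∣ p q = trans (sym (ℚ.∣-p∣≡∣p∣ (p - q)))
    (cong ∣_∣ (solve 2 (λ p q → :- (p :- q) := q :- p) refl p q))

  triangle : ∀ p q r → ∣ p - r ∣ ≤ ∣ p - q ∣ + ∣ q - r ∣
  triangle p q r = begin
    ∣ p - r ∣               ≡⟨ cong ∣_∣ (solve 3 (λ p q r →
                                 p :- r := (p :- q) :+ (q :- r)) refl p q r) ⟩
    ∣ (p - q) + (q - r) ∣   ≤⟨ ℚ.∣p+q∣≤∣p∣+∣q∣ (p - q) (q - r) ⟩
    ∣ p - q ∣ + ∣ q - r ∣   ∎

  p≤q+∣p-q∣ : ∀ p q → p ≤ q + ∣ p - q ∣
  p≤q+∣p-q∣ p q = begin
    p               ≡⟨ solve 2 (λ p q → p := q :+ (p :- q)) refl p q ⟩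
    q + (p - q)     ≤⟨ ℚ.+-monoʳ-≤ q (p≤∣p∣ (p - q)) ⟩
    q + ∣ p - q ∣   ∎

  ∣p-q∣≤ε : ∀ {p q ε} → p ≤ q + ε → q ≤ p + ε → ∣ p - q ∣ ≤ ε
  ∣p-q∣≤ε {p} {q} {ε} h₁ h₂ = ∣p∣≤q
    (0≤q-p⇒p≤q (subst (0ℚ ≤_) (solve 3 (λ p q e → q :+ e :- p := e :- (p :- q)) refl p q ε)
                       (p≤q⇒0≤q-p h₁)))
    (0≤q-p⇒p≤q (subst (0ℚ ≤_) (solve 3 (λ p q e → p :+ e :- q := e :- (:- (p :- q))) refl p q ε)
                       (p≤q⇒0≤q-p h₂)))

  Nonexpansive : (ℚ → ℚ) → Set
  Nonexpansive f = ∀ p q → ∣ f p - f q ∣ ≤ ∣ p - q ∣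

  nonexpansive : ∀ f → (∀ p q → f p ≤ f q + ∣ p - q ∣) → Nonexpansive f
  nonexpansive f h p q = ∣p-q∣≤ε (h p q)
    (subst (λ d → f q ≤ f p + d) (∣p-q∣≡∣q-p∣ q p) (h q p))

  neg-nonexpansive : Nonexpansive (-_)
  neg-nonexpansive p q = ℚ.≤-reflexive (trans
    (cong ∣_∣ (solve 2 (λ p q → :- p :- (:- q) := q :- p) refl p q)) (∣p-q∣≡∣q-p∣ q p))

  abs-nonexpansive : Nonexpansive ∣_∣
  abs-nonexpansive = nonexpansive ∣_∣ λ p q → begin
    ∣ p ∣               ≡⟨ cong ∣_∣ (solve 2 (λ p q → p := q :+ (p :- q)) refl p q) ⟩
    ∣ q + (p - q) ∣     ≤⟨ ℚ.∣p+q∣≤∣p∣+∣q∣ q (p - q) ⟩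
    ∣ q ∣ + ∣ p - q ∣   ∎

  +-bound : ∀ p q r s → ∣ (p + q) - (r + s) ∣ ≤ ∣ p - r ∣ + ∣ q - s ∣
  +-bound p q r s = begin
    ∣ (p + q) - (r + s) ∣   ≡⟨ cong ∣_∣ (solve 4 (λ p q r s →
                                 (p :+ q) :- (r :+ s) := (p :- r) :+ (q :- s)) refl p q r s) ⟩
    ∣ (p - r) + (q - s) ∣   ≤⟨ ℚ.∣p+q∣≤∣p∣+∣q∣ (p - r) (q - s) ⟩
    ∣ p - r ∣ + ∣ q - s ∣   ∎

  *-bound : ∀ p q r s → ∣ p * q - r * s ∣ ≤ ∣ p ∣ * ∣ q - s ∣ + ∣ s ∣ * ∣ p - r ∣
  *-bound p q r s = begin
    ∣ p * q - r * s ∣                       ≡⟨ cong ∣_∣ (solve 4 (λ p q r s →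
                                                 p :* q :- r :* s
                                                 := p :* (q :- s) :+ s :* (p :- r)) refl p q r s) ⟩
    ∣ p * (q - s) + s * (p - r) ∣           ≤⟨ ℚ.∣p+q∣≤∣p∣+∣q∣ (p * (q - s)) (s * (p - r)) ⟩
    ∣ p * (q - s) ∣ + ∣ s * (p - r) ∣       ≡⟨ cong₂ _+_ (ℚ.∣p*q∣≡∣p∣*∣q∣ p (q - s))
                                                         (ℚ.∣p*q∣≡∣p∣*∣q∣ s (p - r)) ⟩
    ∣ p ∣ * ∣ q - s ∣ + ∣ s ∣ * ∣ p - r ∣   ∎

  recip-bound : ∀ {δ p q} → 0ℚ < δ → δ ≤ p → δ ≤ q →
                ∣ recip p - recip q ∣ ≤ (recip δ * recip δ) * ∣ p - q ∣
  recip-bound {δ} {p} {q} 0<δ δ≤p δ≤q = begin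
    ∣ recip p - recip q ∣                                 ≡⟨ cong ∣_∣ step ⟩
    ∣ (recip p * recip q) * (q - p) ∣                     ≡⟨ ℚ.∣p*q∣≡∣p∣*∣q∣ (recip p * recip q) (q - p) ⟩
    ∣ recip p * recip q ∣ * ∣ q - p ∣                     ≡⟨ cong₂ _*_
                                                             (ℚ.0≤p⇒∣p∣≡p (0≤p*q 0≤rp 0≤rq))
                                                             (∣p-q∣≡∣q-p∣ q p) ⟩
    (recip p * recip q) * ∣ p - q ∣                       ≤⟨ ℚ.*-monoʳ-≤-nonNeg ∣ p - q ∣
                                                             {{nonNegative (ℚ.0≤∣p∣ (p - q))}}
                                                             (*-mono-≤-nonNeg 0≤rp 0≤rδ
                                                               (recip-antimono 0<δ δ≤p)
                                                               (recip-antimono 0<δ δ≤q)) ⟩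
    (recip δ * recip δ) * ∣ p - q ∣                       ∎
    where
    0<p : 0ℚ < p
    0<p = ℚ.<-≤-trans 0<δ δ≤p
    0<q : 0ℚ < q
    0<q = ℚ.<-≤-trans 0<δ δ≤q
    0≤rp : 0ℚ ≤ recip p
    0≤rp = ℚ.<⇒≤ (recip-pos 0<p)
    0≤rq : 0ℚ ≤ recip q
    0≤rq = ℚ.<⇒≤ (recip-pos 0<q)
    0≤rδ : 0ℚ ≤ recip δ
    0≤rδ = ℚ.<⇒≤ (recip-pos 0<δ)
    step : recip p - recip q ≡ (recip p * recip q) * (q - p)
    step = begin-equality
      recip p - recip q                                   ≡⟨ cong₂ _-_ (sym (ℚ.*-identityʳ (recip p)))
                                                                       (sym (ℚ.*-identityʳ (recip q))) ⟩
      recip p * 1ℚ - recip q * 1ℚ                         ≡⟨ cong₂ (λ a b → recip p * a - recip q * b)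
                                                               (*-recip 0<q) (*-recip 0<p) ⟨
      recip p * (q * recip q) - recip q * (p * recip p)   ≡⟨ solve 4 (λ p q r s →
                                                               r :* (q :* s) :- s :* (p :* r)
                                                               := (r :* s) :* (q :- p)) refl
                                                               p q (recip p) (recip q) ⟩
      (recip p * recip q) * (q - p)                       ∎

  square-cancel : ∀ {p q k} → 0ℚ ≤ q → p * p ≤ k → k < q * q → p ≤ q
  square-cancel {p} {q} 0≤q p²≤k k<q² with ℚ.≤-total p q
  ... | inj₁ p≤q = p≤q
  ... | inj₂ q≤p = contradiction
    (ℚ.<-≤-trans (ℚ.≤-<-trans p²≤k k<q²)
      (*-mono-≤-nonNeg 0≤q (ℚ.≤-trans 0≤q q≤p) q≤p q≤p))
    (ℚ.<-irrefl refl)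

  fromℤ : ℤ → ℚ
  fromℤ i = i / 1

  fromℤ≡mkℚ : ∀ i → fromℤ i ≡ mkℚ i 0 (ℕ.sym (ℕ.1-coprimeTo ℤ.∣ i ∣))
  fromℤ≡mkℚ i = ℚ.↥p/↧p≡p (mkℚ i 0 (ℕ.sym (ℕ.1-coprimeTo ℤ.∣ i ∣)))

  toℚᵘ-/ : ∀ i d → toℚᵘ (i / suc d) ℚᵘ.≃ ℚᵘ.mkℚᵘ i d
  toℚᵘ-/ i d = ℚ.toℚᵘ-fromℚᵘ (ℚᵘ.mkℚᵘ i d)

  fromℤ-+ : ∀ i j → fromℤ (i ℤ.+ j) ≡ fromℤ i + fromℤ j
  fromℤ-+ i j = ℚ.toℚᵘ-injective (ℚᵘ.≃-trans (toℚᵘ-/ (i ℤ.+ j) 0) (ℚᵘ.≃-trans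
    (ℚᵘ.*≡* (cong (ℤ._* 1ℤ) (cong₂ ℤ._+_ (sym (ℤ.*-identityʳ i)) (sym (ℤ.*-identityʳ j)))))
    (ℚᵘ.≃-sym (ℚᵘ.≃-trans (ℚ.toℚᵘ-homo-+ (fromℤ i) (fromℤ j))
                           (ℚᵘ.+-cong (toℚᵘ-/ i 0) (toℚᵘ-/ j 0))))))

  fromℤ-* : ∀ i j → fromℤ (i ℤ.* j) ≡ fromℤ i * fromℤ j
  fromℤ-* i j = ℚ.toℚᵘ-injective (ℚᵘ.≃-trans (toℚᵘ-/ (i ℤ.* j) 0)
    (ℚᵘ.≃-sym (ℚᵘ.≃-trans (ℚ.toℚᵘ-homo-* (fromℤ i) (fromℤ j))
                           (ℚᵘ.*-cong (toℚᵘ-/ i 0) (toℚᵘ-/ j 0)))))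

  /-*-cancel : ∀ i d → (i / suc d) * fromℤ (+ suc d) ≡ fromℤ i
  /-*-cancel i d = ℚ.toℚᵘ-injective (ℚᵘ.≃-trans (ℚ.toℚᵘ-homo-* (i / suc d) (fromℤ (+ suc d)))
    (ℚᵘ.≃-trans (ℚᵘ.*-cong (toℚᵘ-/ i d) (toℚᵘ-/ (+ suc d) 0))
    (ℚᵘ.≃-trans (ℚᵘ.*≡* (trans (ℤ.*-identityʳ (i ℤ.* + suc d))
                                (cong (λ e → i ℤ.* + suc e) (sym (ℕ.*-identityʳ d)))))
                (ℚᵘ.≃-sym (toℚᵘ-/ i 0)))))

  fromℤ-mono-≤ : ∀ {i j} → i ℤ.≤ j → fromℤ i ≤ fromℤ j
  fromℤ-mono-≤ {i} {j} i≤j rewrite fromℤ≡mkℚ i | fromℤ≡mkℚ j =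
    *≤* (ℤ.*-monoʳ-≤-nonNeg 1ℤ i≤j)

  fromℤ-mono-< : ∀ {i j} → i ℤ.< j → fromℤ i < fromℤ j
  fromℤ-mono-< {i} {j} i<j rewrite fromℤ≡mkℚ i | fromℤ≡mkℚ j =
    *<* (ℤ.*-monoʳ-<-pos 1ℤ i<j)

  archimedean : ∀ {ε} → 0ℚ < ε → ∃[ N ] (∀ n → N ℕ.≤ n → 1ℤ / suc n ≤ ε)
  archimedean {mkℚ (+ zero) _ _}      0<ε = contradiction (positive 0<ε) λ ()
  archimedean {mkℚ (-[1+ _ ]) _ _}    0<ε = contradiction (positive 0<ε) λ ()
  archimedean {mkℚ (+ suc a) d c} _ = d , λ n d≤n →
    subst (_≤ mkℚ (+ suc a) d c) (sym (ℚ.normalize-coprime (ℕ.1-coprimeTo (suc n))))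
      (*≤* (ℤ.+≤+ (ℕ.*-mono-≤ {1} {suc a} {suc d} {suc n} (ℕ.s≤s ℕ.z≤n) (ℕ.s≤s d≤n))))

  0≤/ : ∀ k d → 0ℚ ≤ + k / suc d
  0≤/ k d = ℚ.nonNegative⁻¹ (+ k / suc d) {{ℚ.normalize-nonNeg k (suc d)}}

  floor≤ : ∀ p → fromℤ (floor p) ≤ p
  floor≤ p@(mkℚ n d _) rewrite fromℤ≡mkℚ (floor p) =
    *≤* (subst (floor p ℤ.* + suc d ℤ.≤_) (sym (ℤ.*-identityʳ n)) (ℤ.[n/d]*d≤n n (+ suc d)))

  <suc-floor : ∀ p → p < fromℤ (ℤ.suc (floor p))
  <suc-floor p@(mkℚ n d _) rewrite fromℤ≡mkℚ (ℤ.suc (floor p)) =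
    *<* (subst₂ ℤ._<_ (sym (ℤ.*-identityʳ n))
      (cong (λ z → ℤ.suc z ℤ.* + suc d) (sym (ℤ.div-pos-is-/ℕ n (suc d))))
      (ℤ.n<s[n/ℕd]*d n (suc d)))

  -- The integer nearest to p is one of the two integers surrounding p.
  dist : ℚ → ℚ
  dist p = ∣ p - fromℤ (floor p) ∣ ⊓ ∣ p - fromℤ (ℤ.suc (floor p)) ∣

  dist-attained : ∀ p → ∃[ m ] dist p ≡ ∣ p - fromℤ m ∣
  dist-attained p
    with ℚ.≤-total ∣ p - fromℤ (floor p) ∣ ∣ p - fromℤ (ℤ.suc (floor p)) ∣
  ... | inj₁ h = floor p           , ℚ.p≤q⇒p⊓q≡p h
  ... | inj₂ h = ℤ.suc (floor p)   , ℚ.p≥q⇒p⊓q≡q h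

  dist-≤ : ∀ p m → dist p ≤ ∣ p - fromℤ m ∣
  dist-≤ p m with m ℤ.≤? floor p
  ... | yes m≤⌊p⌋ = begin
    dist p                        ≤⟨ ℚ.p⊓q≤p ∣ p - fromℤ (floor p) ∣ _ ⟩
    ∣ p - fromℤ (floor p) ∣       ≡⟨ ℚ.0≤p⇒∣p∣≡p (p≤q⇒0≤q-p (floor≤ p)) ⟩
    p - fromℤ (floor p)           ≤⟨ ℚ.+-monoʳ-≤ p (ℚ.neg-antimono-≤ (fromℤ-mono-≤ m≤⌊p⌋)) ⟩
    p - fromℤ m                   ≤⟨ p≤∣p∣ (p - fromℤ m) ⟩
    ∣ p - fromℤ m ∣               ∎
  ... | no m≰⌊p⌋ = begin
    dist p                              ≤⟨ ℚ.p⊓q≤q ∣ p - fromℤ (floor p) ∣ _ ⟩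
    ∣ p - fromℤ (ℤ.suc (floor p)) ∣     ≡⟨ ∣p-q∣≡∣q-p∣ p (fromℤ (ℤ.suc (floor p))) ⟩
    ∣ fromℤ (ℤ.suc (floor p)) - p ∣     ≡⟨ ℚ.0≤p⇒∣p∣≡p (p≤q⇒0≤q-p (ℚ.<⇒≤ (<suc-floor p))) ⟩
    fromℤ (ℤ.suc (floor p)) - p         ≤⟨ ℚ.+-monoˡ-≤ (- p) (fromℤ-mono-≤
                                             (ℤ.i<j⇒suc[i]≤j (ℤ.≰⇒> m≰⌊p⌋))) ⟩
    fromℤ m - p                         ≤⟨ p≤∣p∣ (fromℤ m - p) ⟩
    ∣ fromℤ m - p ∣                     ≡⟨ ∣p-q∣≡∣q-p∣ (fromℤ m) p ⟩
    ∣ p - fromℤ m ∣                     ∎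

  dist-nonexpansive : Nonexpansive dist
  dist-nonexpansive = nonexpansive dist λ p q → let m , e = dist-attained q in begin
    dist p                              ≤⟨ dist-≤ p m ⟩
    ∣ p - fromℤ m ∣                     ≤⟨ triangle p q (fromℤ m) ⟩
    ∣ p - q ∣ + ∣ q - fromℤ m ∣         ≡⟨ cong (λ d → ∣ p - q ∣ + d) e ⟨
    ∣ p - q ∣ + dist q                  ≡⟨ ℚ.+-comm ∣ p - q ∣ (dist q) ⟩
    dist q + ∣ p - q ∣                  ∎

  isqrt : ℕ → ℕ
  isqrt zero = zero
  isqrt (suc k) with suc (isqrt k) ℕ.* suc (isqrt k) ℕ.≤? suc k
  ... | yes _ = suc (isqrt k)
  ... | no _  = isqrt k

  isqrt-spec : ∀ k → isqrt k ℕ.* isqrt k ℕ.≤ k × k ℕ.< suc (isqrt k) ℕ.* suc (isqrt k)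
  isqrt-spec zero = ℕ.z≤n , ℕ.s≤s ℕ.z≤n
  isqrt-spec (suc k) with suc (isqrt k) ℕ.* suc (isqrt k) ℕ.≤? suc k | isqrt-spec k
  ... | yes h | _ , hi = h , ℕ.≤-<-trans hi
          (ℕ.*-mono-< (ℕ.n<1+n (suc (isqrt k))) (ℕ.n<1+n (suc (isqrt k))))
  ... | no h  | lo , _ = ℕ.m≤n⇒m≤1+n lo , ℕ.≰⇒> h

  -- ⌊√k·(n+1)⌋/(n+1)
  sqrtApprox : ℕ → ℕ → ℚ
  sqrtApprox k n = + isqrt (k ℕ.* (suc n ℕ.* suc n)) / suc n

  module SqrtApprox (k n : ℕ) where
    private
      K r : ℕ
      K = k ℕ.* (suc n ℕ.* suc n)
      r = isqrt K
      s u D : ℚ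
      s = sqrtApprox k n
      u = 1ℤ / suc n
      D = fromℤ (+ suc n)
      instance
        D>0 : Positive (D * D)
        D>0 = positive (0<p*q {D} {D} 0<D 0<D)
          where
          0<D : 0ℚ < D
          0<D = fromℤ-mono-< {0ℤ} {+ suc n} (ℤ.+<+ (ℕ.s≤s ℕ.z≤n))

      fromℕ-* : ∀ i j → fromℤ (+ (i ℕ.* j)) ≡ fromℤ (+ i) * fromℤ (+ j)
      fromℕ-* i j = trans (cong fromℤ (ℤ.pos-* i j)) (fromℤ-* (+ i) (+ j))

      K≡ : fromℤ (+ K) ≡ fromℤ (+ k) * (D * D)
      K≡ = trans (fromℕ-* k (suc n ℕ.* suc n)) (cong (fromℤ (+ k) *_) (fromℕ-* (suc n) (suc n)))

      s+u : (s + u) * D ≡ fromℤ (+ suc r)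
      s+u = trans (ℚ.*-distribʳ-+ D s u) (trans (cong₂ _+_ (/-*-cancel (+ r) n) (/-*-cancel 1ℤ n))
        (trans (sym (fromℤ-+ (+ r) 1ℤ)) (cong (λ m → fromℤ (+ m)) (ℕ.+-comm r 1))))

      interchange : ∀ a → (a * a) * (D * D) ≡ (a * D) * (a * D)
      interchange a = solve 2 (λ a d → (a :* a) :* (d :* d) := (a :* d) :* (a :* d)) refl a D

    lower : s * s ≤ fromℤ (+ k)
    lower = ℚ.*-cancelʳ-≤-pos (D * D) (begin
      (s * s) * (D * D)           ≡⟨ interchange s ⟩
      (s * D) * (s * D)           ≡⟨ cong₂ _*_ (/-*-cancel (+ r) n) (/-*-cancel (+ r) n) ⟩
      fromℤ (+ r) * fromℤ (+ r)   ≡⟨ fromℕ-* r r ⟨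
      fromℤ (+ (r ℕ.* r))         ≤⟨ fromℤ-mono-≤ (ℤ.+≤+ (proj₁ (isqrt-spec K))) ⟩
      fromℤ (+ K)                 ≡⟨ K≡ ⟩
      fromℤ (+ k) * (D * D)       ∎)

    upper : fromℤ (+ k) < (s + u) * (s + u)
    upper = ℚ.*-cancelʳ-<-nonNeg (D * D) {{ℚ.pos⇒nonNeg (D * D)}} (begin-strict
      fromℤ (+ k) * (D * D)               ≡⟨ K≡ ⟨
      fromℤ (+ K)                         <⟨ fromℤ-mono-< (ℤ.+<+ (proj₂ (isqrt-spec K))) ⟩
      fromℤ (+ (suc r ℕ.* suc r))         ≡⟨ fromℕ-* (suc r) (suc r) ⟩
      fromℤ (+ suc r) * fromℤ (+ suc r)   ≡⟨ cong₂ _*_ s+u s+u ⟨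
      ((s + u) * D) * ((s + u) * D)       ≡⟨ interchange (s + u) ⟨
      ((s + u) * (s + u)) * (D * D)       ∎)

    s≥0 : 0ℚ ≤ s
    s≥0 = 0≤/ r n

    s+u≥0 : 0ℚ ≤ s + u
    s+u≥0 = ℚ.+-mono-≤ s≥0 (0≤/ 1 n)

  sqrtApprox-≤ : ∀ k m n → sqrtApprox k m ≤ sqrtApprox k n + 1ℤ / suc n
  sqrtApprox-≤ k m n = square-cancel (SqrtApprox.s+u≥0 k n) (SqrtApprox.lower k m) (SqrtApprox.upper k n)

open Rational

Eventually : (ℕ → Set) → Set
Eventually P = ∃[ N ] (∀ n → N ℕ.≤ n → P n)

both : ∀ {P Q R : ℕ → Set} → (∀ n → P n → Q n → R n) →
       Eventually P → Eventually Q → Eventually R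
both f (M , p) (N , q) = M ℕ.⊔ N , λ n h →
  f n (p n (ℕ.≤-trans (ℕ.m≤m⊔n M N) h)) (q n (ℕ.≤-trans (ℕ.m≤n⊔m M N) h))

Cauchy : (ℕ → ℚ) → Set
Cauchy f = ∀ ε → 0ℚ ℚ.< ε →
  ∃[ N ] (∀ m n → N ℕ.≤ m → N ℕ.≤ n → ℚ.∣ f m ℚ.- f n ∣ ℚ.≤ ε)

-- Two Cauchy sequences denote the same real number when they are related by _≃_.
record ℝ : Set where
  field
    seq    : ℕ → ℚ
    cauchy : Cauchy seq
open ℝ public

infix 4 _≃_ _≤_ _<_

_≃_ _≤_ _<_ : ℝ → ℝ → Set
x ≃ y = ∀ ε → 0ℚ ℚ.< ε → Eventually λ n → ℚ.∣ seq x n ℚ.- seq y n ∣ ℚ.≤ ε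
x ≤ y = ∀ ε → 0ℚ ℚ.< ε → Eventually λ n → seq x n ℚ.≤ seq y n ℚ.+ ε
x < y = ∃[ ε ] (0ℚ ℚ.< ε × Eventually λ n → seq x n ℚ.+ ε ℚ.≤ seq y n)

bounded : ∀ x → ∃[ B ] (0ℚ ℚ.< B × Eventually λ n → ℚ.∣ seq x n ∣ ℚ.≤ B)
bounded x = let N , h = cauchy x 1ℚ 0<1 in
  ℚ.∣ seq x N ∣ ℚ.+ 1ℚ , ℚ.+-mono-≤-< (ℚ.0≤∣p∣ (seq x N)) 0<1 , N , λ n N≤n → begin
    ℚ.∣ seq x n ∣
      ≤⟨ p≤q+∣p-q∣ ℚ.∣ seq x n ∣ ℚ.∣ seq x N ∣ ⟩
    ℚ.∣ seq x N ∣ ℚ.+ ℚ.∣ ℚ.∣ seq x n ∣ ℚ.- ℚ.∣ seq x N ∣ ∣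
      ≤⟨ ℚ.+-monoʳ-≤ ℚ.∣ seq x N ∣ (ℚ.≤-trans (abs-nonexpansive (seq x n) (seq x N))
                                              (h n N N≤n ℕ.≤-refl)) ⟩
    ℚ.∣ seq x N ∣ ℚ.+ 1ℚ
      ∎
  where open ℚ.≤-Reasoning

constant : ℚ → ℝ
seq    (constant q) _ = q
cauchy (constant q) ε 0<ε = 0 , λ _ _ _ _ →
  subst (λ d → ℚ.∣ d ∣ ℚ.≤ ε) (sym (ℚ.+-inverseʳ q)) (ℚ.<⇒≤ 0<ε)

integer : ℤ → ℝ
integer m = constant (fromℤ m)

0ℝ 1ℝ : ℝ
0ℝ = integer 0ℤ
1ℝ = integer 1ℤ

lift : ∀ f → Nonexpansive f → ℝ → ℝ
seq    (lift f ne x) n = f (seq x n)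
cauchy (lift f ne x) ε 0<ε = let N , h = cauchy x ε 0<ε in
  N , λ m n N≤m N≤n → ℚ.≤-trans (ne (seq x m) (seq x n)) (h m n N≤m N≤n)

infixl 6 _+_ _-_
infixl 7 _*_
infix  8 -_

_+_ : ℝ → ℝ → ℝ
seq    (x + y) n = seq x n ℚ.+ seq y n
cauchy (x + y) ε 0<ε =
  let M , g = cauchy x (half ε) (half-pos 0<ε)
      N , h = cauchy y (half ε) (half-pos 0<ε)
      l = ℕ.m≤m⊔n M N
      r = ℕ.m≤n⊔m M N
  in M ℕ.⊔ N , λ m n hm hn → ℚ.≤-trans
       (+-bound (seq x m) (seq y m) (seq x n) (seq y n))
       (ℚ.≤-trans (ℚ.+-mono-≤ (g m n (ℕ.≤-trans l hm) (ℕ.≤-trans l hn))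
                              (h m n (ℕ.≤-trans r hm) (ℕ.≤-trans r hn)))
                  (ℚ.≤-reflexive (half+half ε)))

-_ : ℝ → ℝ
-_ = lift ℚ.-_ neg-nonexpansive

_-_ : ℝ → ℝ → ℝ
x - y = x + (- y)

∣_∣ : ℝ → ℝ
∣_∣ = lift ℚ.∣_∣ abs-nonexpansive

_*_ : ℝ → ℝ → ℝ
seq    (x * y) n = seq x n ℚ.* seq y n
cauchy (x * y) ε 0<ε =
  let A , 0<A , K , a = bounded x
      B , 0<B , L , b = bounded y
      δ , 0<δ , e     = divide {A ℚ.+ B} (ℚ.+-mono-< 0<A 0<B) 0<ε
      M , g           = cauchy x δ 0<δ
      N , h           = cauchy y δ 0<δ
      T = (K ℕ.⊔ L) ℕ.⊔ (M ℕ.⊔ N)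
      toK = ℕ.≤-trans (ℕ.m≤m⊔n K L) (ℕ.m≤m⊔n (K ℕ.⊔ L) (M ℕ.⊔ N))
      toL = ℕ.≤-trans (ℕ.m≤n⊔m K L) (ℕ.m≤m⊔n (K ℕ.⊔ L) (M ℕ.⊔ N))
      toM = ℕ.≤-trans (ℕ.m≤m⊔n M N) (ℕ.m≤n⊔m (K ℕ.⊔ L) (M ℕ.⊔ N))
      toN = ℕ.≤-trans (ℕ.m≤n⊔m M N) (ℕ.m≤n⊔m (K ℕ.⊔ L) (M ℕ.⊔ N))
      0≤δ = ℚ.<⇒≤ 0<δ
  in T , λ m n hm hn → ℚ.≤-trans
       (*-bound (seq x m) (seq y m) (seq x n) (seq y n))
       (ℚ.≤-trans (ℚ.+-mono-≤
           (*-mono-≤-nonNeg (ℚ.0≤∣p∣ (seq x m)) 0≤δ (a m (ℕ.≤-trans toK hm))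
             (h m n (ℕ.≤-trans toN hm) (ℕ.≤-trans toN hn)))
           (*-mono-≤-nonNeg (ℚ.0≤∣p∣ (seq y n)) 0≤δ (b n (ℕ.≤-trans toL hn))
             (g m n (ℕ.≤-trans toM hm) (ℕ.≤-trans toM hn))))
         (ℚ.≤-reflexive (trans (sym (ℚ.*-distribʳ-+ δ A B)) e)))

eventually≥ : ∀ y → 0ℝ < y → ∃[ δ ] (0ℚ ℚ.< δ × Eventually λ n → δ ℚ.≤ seq y n)
eventually≥ y (δ , 0<δ , N , h) = δ , 0<δ , N , λ n N≤n →
  subst (ℚ._≤ seq y n) (ℚ.+-identityˡ δ) (h n N≤n)

inverse : (y : ℝ) → 0ℝ < y → ℝ
seq    (inverse y 0<y) n = recip (seq y n)
cauchy (inverse y 0<y) ε 0<ε =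
  let δ , 0<δ , K , a = eventually≥ y 0<y
      R               = recip δ ℚ.* recip δ
      0<R             = 0<p*q (recip-pos 0<δ) (recip-pos 0<δ)
      η , 0<η , e     = divide {R} 0<R 0<ε
      N , h           = cauchy y η 0<η
      l = ℕ.m≤m⊔n K N
      r = ℕ.m≤n⊔m K N
  in K ℕ.⊔ N , λ m n hm hn → ℚ.≤-trans
       (recip-bound 0<δ (a m (ℕ.≤-trans l hm)) (a n (ℕ.≤-trans l hn)))
       (ℚ.≤-trans (ℚ.*-monoˡ-≤-nonNeg R {{ℚ.nonNegative (ℚ.<⇒≤ 0<R)}}
                     (h m n (ℕ.≤-trans r hm) (ℕ.≤-trans r hn)))
                  (ℚ.≤-reflexive e))

infixl 7 _/_[_]

_/_[_] : (x y : ℝ) → 0ℝ < y → ℝ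
x / y [ 0<y ] = x * inverse y 0<y

*-inverseʳ : ∀ y (0<y : 0ℝ < y) → y * inverse y 0<y ≃ 1ℝ
*-inverseʳ y 0<y ε 0<ε =
  let δ , 0<δ , N , h = eventually≥ y 0<y in
  N , λ n N≤n → subst (λ p → ℚ.∣ p ℚ.- 1ℚ ∣ ℚ.≤ ε)
    (sym (*-recip (ℚ.<-≤-trans 0<δ (h n N≤n)))) (ℚ.<⇒≤ 0<ε)

IsInteger : ℝ → Set
IsInteger x = ∃[ m ] x ≃ integer m

-- dist is 1-Lipschitz, so it extends termwise to ℝ.  The next two lemmas show
-- that ‖ x ‖ is the infimum of the numbers ∣ x - m ∣, m ∈ ℤ, which is their
-- minimum because only finitely many of them lie below any given bound.
‖_‖ : ℝ → ℝ
‖_‖ = lift dist dist-nonexpansive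

‖‖-lowerBound : ∀ x m → ‖ x ‖ ≤ ∣ x - integer m ∣
‖‖-lowerBound x m ε 0<ε = 0 , λ n _ → begin
  dist (seq x n)                                   ≤⟨ dist-≤ (seq x n) m ⟩
  ℚ.∣ seq x n ℚ.- fromℤ m ∣                        ≡⟨ ℚ.+-identityʳ _ ⟨
  ℚ.∣ seq x n ℚ.- fromℤ m ∣ ℚ.+ 0ℚ                 ≤⟨ ℚ.+-monoʳ-≤ ℚ.∣ seq x n ℚ.- fromℤ m ∣ (ℚ.<⇒≤ 0<ε) ⟩
  ℚ.∣ seq x n ℚ.- fromℤ m ∣ ℚ.+ ε                  ∎
  where open ℚ.≤-Reasoning

‖‖-greatest : ∀ x y → (∀ m → y ≤ ∣ x - integer m ∣) → y ≤ ‖ x ‖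
‖‖-greatest x y y≤ ε 0<ε =
  let q     = half (half ε)
      N , h = cauchy x q (half-pos (half-pos 0<ε))
      z     = seq x N
      m , e = dist-attained z
  in both (λ n y-bound x-bound → begin
       seq y n
         ≤⟨ y-bound ⟩
       ℚ.∣ seq x n ℚ.- fromℤ m ∣ ℚ.+ half ε
         ≤⟨ ℚ.+-monoˡ-≤ (half ε) (triangle (seq x n) z (fromℤ m)) ⟩
       ℚ.∣ seq x n ℚ.- z ∣ ℚ.+ ℚ.∣ z ℚ.- fromℤ m ∣ ℚ.+ half ε
         ≡⟨ cong (λ d → ℚ.∣ seq x n ℚ.- z ∣ ℚ.+ d ℚ.+ half ε) e ⟨
       ℚ.∣ seq x n ℚ.- z ∣ ℚ.+ dist z ℚ.+ half ε
         ≤⟨ ℚ.+-monoˡ-≤ (half ε) (ℚ.+-mono-≤ x-bound (ℚ.≤-trans (dist-step (seq x n) z)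
              (ℚ.+-monoʳ-≤ (dist (seq x n)) x-bound))) ⟩
       q ℚ.+ (dist (seq x n) ℚ.+ q) ℚ.+ half ε
         ≡⟨ solve 3 (λ q d t → q :+ (d :+ q) :+ t := d :+ ((q :+ q) :+ t)) refl
              q (dist (seq x n)) (half ε) ⟩
       dist (seq x n) ℚ.+ (q ℚ.+ q ℚ.+ half ε)
         ≡⟨ cong (λ t → dist (seq x n) ℚ.+ t)
              (trans (cong (ℚ._+ half ε) (half+half (half ε))) (half+half ε)) ⟩
       dist (seq x n) ℚ.+ ε
         ∎)
     (y≤ m (half ε) (half-pos 0<ε))
     (N , λ n N≤n → h n N N≤n ℕ.≤-refl)
  where
  open ℚ.≤-Reasoning
  open +-*-Solver
  dist-step : ∀ p q → dist q ℚ.≤ dist p ℚ.+ ℚ.∣ p ℚ.- q ∣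
  dist-step p q = ℚ.≤-trans (p≤q+∣p-q∣ (dist q) (dist p))
    (ℚ.+-monoʳ-≤ (dist p) (ℚ.≤-trans (dist-nonexpansive q p)
      (ℚ.≤-reflexive (∣p-q∣≡∣q-p∣ q p))))

infix 9 √_

-- Determined up to _≃_ by √-nonNeg and √-square below.
√_ : ℕ → ℝ
seq    (√ k) = sqrtApprox k
cauchy (√ k) ε 0<ε = let N , h = archimedean 0<ε in
  N , λ m n N≤m N≤n → ∣p-q∣≤ε
    (ℚ.≤-trans (sqrtApprox-≤ k m n) (ℚ.+-monoʳ-≤ (sqrtApprox k n) (h n N≤n)))
    (ℚ.≤-trans (sqrtApprox-≤ k n m) (ℚ.+-monoʳ-≤ (sqrtApprox k m) (h m N≤m)))

√-nonNeg : ∀ k → 0ℝ ≤ √ k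
√-nonNeg k ε 0<ε = 0 , λ n _ → ℚ.+-mono-≤ (SqrtApprox.s≥0 k n) (ℚ.<⇒≤ 0<ε)

√-square : ∀ k → √ k * √ k ≃ integer (+ k)
√-square k ε 0<ε =
  let B , 0<B , b = bounded (√ k)
      δ , 0<δ , e = divide {B ℚ.+ B ℚ.+ 1ℚ} (ℚ.+-mono-< (ℚ.+-mono-< 0<B 0<B) 0<1) 0<ε
      near        = archimedean 0<δ
      small       = archimedean 0<1
  in both (λ n s≤B (u≤δ , u≤1) →
       let s = sqrtApprox k n
           u = 1ℤ ℚ./ suc n
           s≤B′ = ℚ.≤-trans (p≤∣p∣ s) s≤B
           s≥0 = SqrtApprox.s≥0 k n
           u≥0 = 0≤/ 1 n
       in ∣p-q∣≤ε
         (ℚ.≤-trans (SqrtApprox.lower k n)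
           (ℚ.≤-trans (ℚ.≤-reflexive (sym (ℚ.+-identityʳ (fromℤ (+ k)))))
                      (ℚ.+-monoʳ-≤ (fromℤ (+ k)) (ℚ.<⇒≤ 0<ε))))
         (begin
           fromℤ (+ k)
             ≤⟨ ℚ.<⇒≤ (SqrtApprox.upper k n) ⟩
           (s ℚ.+ u) ℚ.* (s ℚ.+ u)
             ≡⟨ solve 2 (λ s u → (s :+ u) :* (s :+ u)
                                 := s :* s :+ (s :+ s :+ u) :* u) refl s u ⟩
           s ℚ.* s ℚ.+ (s ℚ.+ s ℚ.+ u) ℚ.* u
             ≤⟨ ℚ.+-monoʳ-≤ (s ℚ.* s) (*-mono-≤-nonNeg
                  (ℚ.+-mono-≤ (ℚ.+-mono-≤ s≥0 s≥0) u≥0) (ℚ.<⇒≤ 0<δ)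
                  (ℚ.+-mono-≤ (ℚ.+-mono-≤ s≤B′ s≤B′) u≤1) u≤δ) ⟩
           s ℚ.* s ℚ.+ (B ℚ.+ B ℚ.+ 1ℚ) ℚ.* δ
             ≡⟨ cong (λ t → s ℚ.* s ℚ.+ t) e ⟩
           s ℚ.* s ℚ.+ ε
             ∎))
     b (both (λ _ → _,_) near small)
  where
  open ℚ.≤-Reasoning
  open +-*-Solver

√-pos : ∀ {k} → 0 ℕ.< k → 0ℝ < √ k
√-pos {k} 0<k = let N , h = archimedean 0<½ in
  ½ , 0<½ , N , λ n N≤n →
    let s   = sqrtApprox k n
        1≤s+½ : 1ℚ ℚ.≤ s ℚ.+ ½
        1≤s+½ = ℚ.≤-trans
          (square-cancel (SqrtApprox.s+u≥0 k n)
            (fromℤ-mono-≤ {1ℤ} {+ k} (ℤ.+≤+ 0<k)) (SqrtApprox.upper k n))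
          (ℚ.+-monoʳ-≤ s (h n N≤n))
    in 0≤q-p⇒p≤q (subst (0ℚ ℚ.≤_)
         (solve 1 (λ s → s :+ con ½ :- con 1ℚ := s :- (con 0ℚ :+ con ½)) refl s)
         (p≤q⇒0≤q-p 1≤s+½))
  where open +-*-Solver

-- n^(7/2) = √(n⁷)
infix 9 _^⁷ᐟ²

_^⁷ᐟ² : ℕ → ℝ
n ^⁷ᐟ² = √ (n ^ 7)

^⁷ᐟ²-pos : ∀ {n} → 1 ℕ.≤ n → 0ℝ < n ^⁷ᐟ²
^⁷ᐟ²-pos {n@(suc _)} _ = √-pos (ℕ.m^n>0 n 7)

{-# OPTIONS --safe #-}

-- Let e = √a + √b + √c - m with m an integer.  The norm of e is, up to sign, the
-- product of e and its seven conjugates, and each conjugate is 2t - e for the sum t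
-- of some nonempty subset of the three roots.  If ∣ e ∣ ≤ ¾, every conjugate lies
-- between 1 and a multiple of √n, so e vanishes together with its norm; otherwise
-- the norm, being a nonzero integer, gives ∣ e ∣ ≥ 1 / (const · √n ^ 7).  No Galois
-- theory is needed when a, b, c are multiplicatively dependent, because e itself is
-- the only factor that can be small.

module Submission where

import Defs
import Algebra.Bundles as Algebra
open import Data.Integer.Base as ℤ using (ℤ; +_; 0ℤ; 1ℤ)
import Data.Integer.Properties as ℤ
open import Data.List.Base using (List; []; _∷_; foldr; length; map)
open import Data.List.Relation.Unary.All using (All; []; _∷_)
import Data.List.Relation.Unary.All.Properties as All
open import Data.Nat.Base as ℕ using (ℕ; zero; suc)
import Data.Nat.Properties as ℕ
open import Data.Product using (Σ-syntax; _×_; _,_; proj₁; proj₂)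
open import Data.Rational.Base as ℚ using (ℚ; 0ℚ; 1ℚ; ½)
import Data.Rational.Properties as ℚ
open import Data.Rational.Solver using (module +-*-Solver)
open import Relation.Binary.PropositionalEquality
  using (_≡_; _≢_; refl; sym; trans; cong; cong₂; subst)
open import Relation.Nullary using (¬_; Dec; yes; no; contradiction)
open import Relation.Nullary.Decidable using (toWitness)

-- The operations are parameters so that one formula serves three times: on rationals, on reals, and
-- on the formal polynomials of the ring solver.
module NormForm {A : Set} (_⊕_ _⊖_ _⊛_ : A → A → A) (four : A) where

  -- f² a - e², where e + f √a is the product of m + √a ± √b ± √c over the signs.
  norm : (m a b c : A) → A
  norm m a b c = ((f ⊛ f) ⊛ a) ⊖ (e ⊛ e)
    where
    g = (((m ⊛ m) ⊕ a) ⊖ b) ⊖ c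
    e = (g ⊛ g) ⊕ (four ⊛ (((m ⊛ m) ⊛ a) ⊖ (b ⊛ c)))
    f = (four ⊛ m) ⊛ g

open NormForm

-- Rational inequalities.

module RationalBounds where
  open import Data.Rational.Base using (_+_; _*_; _-_; -_; ∣_∣; _≤_; _<_; _/_; nonNegative)
  open Defs.Rational
  open import Algebra.Properties.CommutativeSemiring.Exp
    (Algebra.CommutativeRing.commutativeSemiring ℚ.+-*-commutativeRing) public
    using (_^_; ^-distrib-*)
  open ℚ.≤-Reasoning
  open +-*-Solver

  ⅛ ⅝ ¾ ⅞ : ℚ
  ⅛ = + 1 / 8
  ⅝ = + 5 / 8
  ¾ = + 3 / 4
  ⅞ = + 7 / 8

  p≤p+q : ∀ {p q} → 0ℚ ≤ q → p ≤ p + q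
  p≤p+q {p} {q} 0≤q = subst (_≤ p + q) (ℚ.+-identityʳ p) (ℚ.+-monoʳ-≤ p 0≤q)

  -p≤∣p∣ : ∀ p → - p ≤ ∣ p ∣
  -p≤∣p∣ p = subst (- p ≤_) (ℚ.∣-p∣≡∣p∣ p) (p≤∣p∣ (- p))

  -- Reverse triangle inequality: `r + s ≤ ∣ q ∣ ≤ ∣ p ∣ + s`, and `s` cancels.
  ∣p∣-lowerBound : ∀ {p q r s} → r + s ≤ ∣ q ∣ → ∣ p - q ∣ ≤ s → r ≤ ∣ p ∣
  ∣p∣-lowerBound {p} {q} {r} {s} r+s≤q p-q≤s = 0≤q-p⇒p≤q (subst (0ℚ ≤_)
    (solve 3 (λ p r s → p :+ s :- (r :+ s) := p :- r) refl ∣ p ∣ r s)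
    (p≤q⇒0≤q-p (begin
      r + s               ≤⟨ r+s≤q ⟩
      ∣ q ∣               ≤⟨ p≤q+∣p-q∣ ∣ q ∣ ∣ p ∣ ⟩
      ∣ p ∣ + ∣ ∣ q ∣ - ∣ p ∣ ∣  ≤⟨ ℚ.+-monoʳ-≤ ∣ p ∣ (abs-nonexpansive q p) ⟩
      ∣ p ∣ + ∣ q - p ∣   ≡⟨ cong (λ d → ∣ p ∣ + d) (∣p-q∣≡∣q-p∣ q p) ⟩
      ∣ p ∣ + ∣ p - q ∣   ≤⟨ ℚ.+-monoʳ-≤ ∣ p ∣ p-q≤s ⟩
      ∣ p ∣ + s           ∎)))

  -- Multiply the hypothesis by `recip p * recip q`. The conclusion has the shape of a term of C /
  -- n^(7/2).
  recip-*-≤ : ∀ {p q r} → 0ℚ < p → 0ℚ < q → 1ℚ ≤ r * (p * q) → recip p * recip q ≤ r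
  recip-*-≤ {p} {q} {r} 0<p 0<q 1≤ = begin
    recip p * recip q                          ≡⟨ ℚ.*-identityˡ _ ⟨
    1ℚ * (recip p * recip q)                   ≤⟨ ℚ.*-monoʳ-≤-nonNeg (recip p * recip q)
                                                    {{nonNegative (ℚ.<⇒≤ (0<p*q (recip-pos 0<p) (recip-pos 0<q)))}} 1≤ ⟩
    (r * (p * q)) * (recip p * recip q)        ≡⟨ solve 5 (λ r p q p′ q′ →
                                                    (r :* (p :* q)) :* (p′ :* q′)
                                                    := r :* ((p :* p′) :* (q :* q′))) refl
                                                    r p q (recip p) (recip q) ⟩
    r * ((p * recip p) * (q * recip q))        ≡⟨ cong (r *_) (cong₂ _*_ (*-recip 0<p) (*-recip 0<q)) ⟩
    r * 1ℚ                                     ≡⟨ ℚ.*-identityʳ r ⟩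
    r                                          ∎

  ^-nonNeg : ∀ {p} → 0ℚ ≤ p → ∀ n → 0ℚ ≤ p ^ n
  ^-nonNeg 0≤p zero    = 0≤1
  ^-nonNeg 0≤p (suc n) = 0≤p*q 0≤p (^-nonNeg 0≤p n)

  ^-pos : ∀ {p} → 0ℚ < p → ∀ n → 0ℚ < p ^ n
  ^-pos 0<p zero    = 0<1
  ^-pos 0<p (suc n) = 0<p*q 0<p (^-pos 0<p n)

  ^-monoˡ-≤ : ∀ {p q} → 0ℚ ≤ p → p ≤ q → ∀ n → p ^ n ≤ q ^ n
  ^-monoˡ-≤ 0≤p p≤q zero    = ℚ.≤-refl
  ^-monoˡ-≤ 0≤p p≤q (suc n) = *-mono-≤-nonNeg 0≤p
    (^-nonNeg (ℚ.≤-trans 0≤p p≤q) n) p≤q (^-monoˡ-≤ 0≤p p≤q n)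

  fromℤ-^ : ∀ k n → fromℤ (+ (k ℕ.^ n)) ≡ fromℤ (+ k) ^ n
  fromℤ-^ k zero    = refl
  fromℤ-^ k (suc n) = trans (cong fromℤ (ℤ.pos-* k (k ℕ.^ n)))
    (trans (fromℤ-* (+ k) (+ (k ℕ.^ n))) (cong (fromℤ (+ k) *_) (fromℤ-^ k n)))

  1≤∣fromℤ∣ : ∀ {i} → i ≢ 0ℤ → 1ℚ ≤ ∣ fromℤ i ∣
  1≤∣fromℤ∣ {+ zero}      i≢0 = contradiction refl i≢0
  1≤∣fromℤ∣ {+ suc k}     _   = ℚ.≤-trans (fromℤ-mono-≤ {1ℤ} {+ suc k} (ℤ.+≤+ (ℕ.s≤s ℕ.z≤n)))
                                          (p≤∣p∣ (fromℤ (+ suc k)))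
  1≤∣fromℤ∣ {ℤ.-[1+ k ]}  _   = ℚ.≤-trans (ℚ.neg-antimono-≤ {fromℤ ℤ.-[1+ k ]} {fromℤ ℤ.-1ℤ}
                                            (fromℤ-mono-≤ {ℤ.-[1+ k ]} {ℤ.-1ℤ} (ℤ.-≤- ℕ.z≤n)))
                                          (-p≤∣p∣ (fromℤ (ℤ.-[1+ k ])))

  product : List ℚ → ℚ
  product = foldr _*_ 1ℚ

  product-bounds : ∀ {u fs} → All (λ f → 1ℚ ≤ f × f ≤ u) fs →
                   1ℚ ≤ product fs × product fs ≤ u ^ length fs
  product-bounds []                  = ℚ.≤-refl , ℚ.≤-refl
  product-bounds ((1≤f , f≤u) ∷ fs) =
    let lo , hi = product-bounds fs in
    *-mono-≤-nonNeg 0≤1 (ℚ.≤-trans 0≤1 lo) 1≤f lo ,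
    *-mono-≤-nonNeg (ℚ.≤-trans 0≤1 1≤f) (ℚ.≤-trans (ℚ.≤-trans 0≤1 lo) hi) f≤u hi

  -- The conjugates of x + y + z - m and their product.

  module Conjugates (m x y z : ℚ) where

    e : ℚ
    e = x + y + z - m

    subsetSums : List ℚ
    subsetSums = x ∷ y ∷ z ∷ x + y ∷ x + z ∷ y + z ∷ x + y + z ∷ []

    -- If `t` sums a subset of the roots, this is minus the result of flipping the signs of those
    -- roots in `e`. With the extra minus sign, all seven values are positive when `e` is small.
    conjugate : ℚ → ℚ
    conjugate t = t + t - e

    cofactor : ℚ
    cofactor = product (map conjugate subsetSums)

    -- A polynomial identity in four variables, so it holds exactly for rational approximations of
    -- the roots. The empty subset would contribute `- e`; using `e` instead accounts for the sign
    -- of `norm`.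
    e*cofactor≡norm : e * cofactor ≡
      norm _+_ _-_ _*_ (fromℤ (+ 4)) m (x * x) (y * y) (z * z)
    e*cofactor≡norm = solve 4 (λ m x y z →
      let e = x :+ y :+ z :- m
          j = λ t → t :+ t :- e
      in e :* (j x :* (j y :* (j z :* (j (x :+ y) :* (j (x :+ z) :* (j (y :+ z)
           :* (j (x :+ y :+ z) :* con 1ℚ)))))))
         := norm _:+_ _:-_ _:*_ (con (fromℤ (+ 4))) m (x :* x) (y :* y) (z :* z))
      refl m x y z

    -- Each subset sum t lies between 7/8 and 6w. Hence 2t - e is at least 7/4 - 3/4 = 1, and at
    -- most 12w + 3/4 ≤ 13w.
    cofactor-bounds : ∀ {w} → ∣ e ∣ ≤ ¾ → ⅞ ≤ w →
      ⅞ ≤ x → x ≤ w + w → ⅞ ≤ y → y ≤ w + w → ⅞ ≤ z → z ≤ w + w →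
      1ℚ ≤ cofactor × cofactor ≤ (fromℤ (+ 13) * w) ^ 7
    cofactor-bounds {w} ∣e∣≤¾ ⅞≤w ⅞≤x x≤2w ⅞≤y y≤2w ⅞≤z z≤2w =
      product-bounds (All.map⁺ {P = Bounded} {xs = subsetSums} {f = conjugate} (
        one ⅞≤x x≤2w ∷ one ⅞≤y y≤2w ∷ one ⅞≤z z≤2w ∷
        two ⅞≤x x≤2w ⅞≤y y≤2w ∷ two ⅞≤x x≤2w ⅞≤z z≤2w ∷ two ⅞≤y y≤2w ⅞≤z z≤2w ∷
        conjugate-bounds (ℚ.≤-trans (ℚ.≤-trans ⅞≤x (p≤p+q (≥0 ⅞≤y))) (p≤p+q (≥0 ⅞≤z)))
                         (ℚ.+-mono-≤ (ℚ.+-mono-≤ x≤2w y≤2w) z≤2w) ∷ []))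
      where
      Bounded : ℚ → Set
      Bounded f = 1ℚ ≤ f × f ≤ fromℤ (+ 13) * w
      u : ℚ
      u = w + w
      ≥0 : ∀ {p} → ⅞ ≤ p → 0ℚ ≤ p
      ≥0 = ℚ.≤-trans (0≤/ 7 7)
      u≥0 : 0ℚ ≤ u
      u≥0 = ℚ.+-mono-≤ (≥0 ⅞≤w) (≥0 ⅞≤w)
      conjugate-bounds : ∀ {t} → ⅞ ≤ t → t ≤ u + u + u →
                         Bounded (conjugate t)
      conjugate-bounds {t} ⅞≤t t≤3u =
        ℚ.+-mono-≤ (ℚ.+-mono-≤ ⅞≤t ⅞≤t)
                   (ℚ.neg-antimono-≤ (ℚ.≤-trans (p≤∣p∣ e) ∣e∣≤¾)) ,
        (begin
          t + t - e
            ≤⟨ ℚ.+-mono-≤ (ℚ.+-mono-≤ t≤3u t≤3u) (ℚ.≤-trans (-p≤∣p∣ e)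
                 (ℚ.≤-trans ∣e∣≤¾ (ℚ.≤-trans (toWitness {a? = ¾ ℚ.≤? ⅞} _) ⅞≤w))) ⟩
          (u + u + u) + (u + u + u) + w
            ≡⟨ solve 1 (λ w → let u = w :+ w in (u :+ u :+ u) :+ (u :+ u :+ u) :+ w
                                := con (fromℤ (+ 13)) :* w) refl w ⟩
          fromℤ (+ 13) * w
            ∎)
      one : ∀ {t} → ⅞ ≤ t → t ≤ u → Bounded (conjugate t)
      one ⅞≤t t≤u = conjugate-bounds ⅞≤t (ℚ.≤-trans t≤u (ℚ.≤-trans (p≤p+q u≥0) (p≤p+q u≥0)))
      two : ∀ {s t} → ⅞ ≤ s → s ≤ u → ⅞ ≤ t → t ≤ u →
            Bounded (conjugate (s + t))
      two ⅞≤s s≤u ⅞≤t t≤u = conjugate-bounds (ℚ.≤-trans ⅞≤s (p≤p+q (≥0 ⅞≤t)))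
        (ℚ.≤-trans (ℚ.+-mono-≤ s≤u t≤u) (p≤p+q u≥0))

  -- Comparison of rational approximations to square roots.

  sqrtApprox-≥⅞ : ∀ {a k} → 1 ℕ.≤ a → 1ℤ / suc k ≤ ⅛ → ⅞ ≤ sqrtApprox a k
  sqrtApprox-≥⅞ {a} {k} 1≤a u≤⅛ = 0≤q-p⇒p≤q (subst (0ℚ ≤_)
    (solve 1 (λ s → s :+ con ⅛ :- con 1ℚ := s :- con ⅞) refl (sqrtApprox a k))
    (p≤q⇒0≤q-p (ℚ.≤-trans
      -- From 1 ≤ a < (s + u)² follows 1 ≤ s + u; the truncation error u ≤ 1/8 leaves s ≥ 7/8.
      (square-cancel {1ℚ} {sqrtApprox a k + 1ℤ / suc k} (SqrtApprox.s+u≥0 a k)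
        (fromℤ-mono-≤ {1ℤ} {+ a} (ℤ.+≤+ 1≤a)) (SqrtApprox.upper a k))
      (ℚ.+-monoʳ-≤ (sqrtApprox a k) u≤⅛))))

  -- Absorbs the additive truncation error into a factor 2, which costs only a constant in the end.
  sqrtApprox+u≤2* : ∀ {n k} → 1 ℕ.≤ n → 1ℤ / suc k ≤ ⅛ →
                    sqrtApprox n k + 1ℤ / suc k ≤ sqrtApprox n k + sqrtApprox n k
  sqrtApprox+u≤2* {n} {k} 1≤n u≤⅛ = ℚ.+-monoʳ-≤ (sqrtApprox n k)
    (ℚ.≤-trans u≤⅛ (ℚ.≤-trans (toWitness {a? = ⅛ ℚ.≤? ⅞} _) (sqrtApprox-≥⅞ {n} {k} 1≤n u≤⅛)))

  sqrtApprox-mono : ∀ {a n k} → a ℕ.≤ n → 1 ℕ.≤ n → 1ℤ / suc k ≤ ⅛ →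
                    sqrtApprox a k ≤ sqrtApprox n k + sqrtApprox n k
  sqrtApprox-mono {a} {n} {k} a≤n 1≤n u≤⅛ = ℚ.≤-trans
    (square-cancel (SqrtApprox.s+u≥0 n k)
      (ℚ.≤-trans (SqrtApprox.lower a k) (fromℤ-mono-≤ {+ a} {+ n} (ℤ.+≤+ a≤n))) (SqrtApprox.upper n k))
    (sqrtApprox+u≤2* {n} {k} 1≤n u≤⅛)

  -- The square of the left side is at most n^j, by `SqrtApprox.lower`. This links the product of
  -- seven conjugates, of order (√n)^7, to n^(7/2) taken as √(n^7).
  sqrtApprox-^ : ∀ {n k} j → 1 ℕ.≤ n → 1ℤ / suc k ≤ ⅛ →
    sqrtApprox n k ^ j ≤ sqrtApprox (n ℕ.^ j) k + sqrtApprox (n ℕ.^ j) k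
  sqrtApprox-^ {n@(suc _)} {k} j 1≤n u≤⅛ = ℚ.≤-trans
    (square-cancel (SqrtApprox.s+u≥0 (n ℕ.^ j) k)
      (begin
        w ^ j * w ^ j         ≡⟨ ^-distrib-* w w j ⟨
        (w * w) ^ j           ≤⟨ ^-monoˡ-≤ (0≤p*q (SqrtApprox.s≥0 n k) (SqrtApprox.s≥0 n k))
                                           (SqrtApprox.lower n k) j ⟩
        fromℤ (+ n) ^ j       ≡⟨ fromℤ-^ n j ⟨
        fromℤ (+ (n ℕ.^ j))   ∎)
      (SqrtApprox.upper (n ℕ.^ j) k))
    (sqrtApprox+u≤2* {n ℕ.^ j} {k} (ℕ.m^n>0 n j) u≤⅛)
    where
    w : ℚ
    w = sqrtApprox n k

  -- `K` collects the factor 13 of each of the seven conjugates. The 4 in `L` is one 2 from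
  -- `sqrtApprox-^` and one 2 from bounding the norm below by 1/2 only. The final constant is 1/L.
  K L : ℚ
  K = fromℤ (+ 13) ^ 7
  L = fromℤ (+ 4) * K

  0<K : 0ℚ < K
  0<K = ^-pos (ℚ.positive⁻¹ (fromℤ (+ 13))) 7

  0<L : 0ℚ < L
  0<L = 0<p*q (ℚ.positive⁻¹ (fromℤ (+ 4))) 0<K

  4≤L : fromℤ (+ 4) ≤ L
  4≤L = toWitness {a? = fromℤ (+ 4) ℚ.≤? L} _

open RationalBounds

open import Defs
open Rational

-- Closure of integer-valued reals under ring operations.

integer-+ : ∀ {x y i j} → x ≃ integer i → y ≃ integer j → x + y ≃ integer (i ℤ.+ j)
integer-+ {x} {y} {i} {j} x≃i y≃j ε 0<ε = both (λ n x-i y-j → begin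
    ℚ.∣ seq x n ℚ.+ seq y n ℚ.- fromℤ (i ℤ.+ j) ∣
      ≡⟨ cong (λ t → ℚ.∣ seq x n ℚ.+ seq y n ℚ.- t ∣) (fromℤ-+ i j) ⟩
    ℚ.∣ seq x n ℚ.+ seq y n ℚ.- (fromℤ i ℚ.+ fromℤ j) ∣
      ≤⟨ +-bound (seq x n) (seq y n) (fromℤ i) (fromℤ j) ⟩
    ℚ.∣ seq x n ℚ.- fromℤ i ∣ ℚ.+ ℚ.∣ seq y n ℚ.- fromℤ j ∣
      ≤⟨ ℚ.+-mono-≤ x-i y-j ⟩
    half ε ℚ.+ half ε
      ≡⟨ half+half ε ⟩
    ε ∎)
  (x≃i (half ε) (half-pos 0<ε)) (y≃j (half ε) (half-pos 0<ε))
  where open ℚ.≤-Reasoning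

integer-* : ∀ {x y i j} → x ≃ integer i → y ≃ integer j → x * y ≃ integer (i ℤ.* j)
integer-* {x} {y} {i} {j} x≃i y≃j ε 0<ε =
  let B , 0<B , x≤B = bounded x
      J , 0<J , j≤J = bounded (integer j)
      δ , 0<δ , e   = divide {B ℚ.+ J} (ℚ.+-mono-< 0<B 0<J) 0<ε
      0≤δ           = ℚ.<⇒≤ 0<δ
  in both (λ n (x-i , y-j) (∣x∣≤B , ∣j∣≤J) → begin
    ℚ.∣ seq x n ℚ.* seq y n ℚ.- fromℤ (i ℤ.* j) ∣
      ≡⟨ cong (λ t → ℚ.∣ seq x n ℚ.* seq y n ℚ.- t ∣) (fromℤ-* i j) ⟩
    ℚ.∣ seq x n ℚ.* seq y n ℚ.- fromℤ i ℚ.* fromℤ j ∣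
      ≤⟨ *-bound (seq x n) (seq y n) (fromℤ i) (fromℤ j) ⟩
    ℚ.∣ seq x n ∣ ℚ.* ℚ.∣ seq y n ℚ.- fromℤ j ∣ ℚ.+ ℚ.∣ fromℤ j ∣ ℚ.* ℚ.∣ seq x n ℚ.- fromℤ i ∣
      ≤⟨ ℚ.+-mono-≤ (*-mono-≤-nonNeg (ℚ.0≤∣p∣ (seq x n)) 0≤δ ∣x∣≤B y-j)
                    (*-mono-≤-nonNeg (ℚ.0≤∣p∣ (fromℤ j)) 0≤δ ∣j∣≤J x-i) ⟩
    B ℚ.* δ ℚ.+ J ℚ.* δ
      ≡⟨ trans (sym (ℚ.*-distribʳ-+ δ B J)) e ⟩
    ε ∎)
  (both (λ _ → _,_) (x≃i δ 0<δ) (y≃j δ 0<δ)) (both (λ _ → _,_) x≤B j≤J)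
  where open ℚ.≤-Reasoning

integer-neg : ∀ {x i} → x ≃ integer i → - x ≃ integer (ℤ.- i)
integer-neg {x} {i} x≃i ε 0<ε = let N , h = x≃i ε 0<ε in N , λ n N≤n →
  ℚ.≤-trans (subst (λ t → ℚ.∣ ℚ.- seq x n ℚ.- t ∣ ℚ.≤ ℚ.∣ seq x n ℚ.- fromℤ i ∣)
    (sym (fromℤ-neg i)) (neg-nonexpansive (seq x n) (fromℤ i))) (h n N≤n)
  where
  open +-*-Solver using (solve; _:=_; :-_)
  fromℤ-neg : ∀ i → fromℤ (ℤ.- i) ≡ ℚ.- fromℤ i
  fromℤ-neg (+ zero)       = refl
  fromℤ-neg (+ suc _)      = refl
  fromℤ-neg (ℤ.-[1+ k ])   = solve 1 (λ p → p := :- (:- p)) refl (fromℤ (+ suc k))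

isInteger-integer : ∀ i → IsInteger (integer i)
isInteger-integer i = i , λ ε 0<ε → 0 , λ _ _ →
  subst (λ d → ℚ.∣ d ∣ ℚ.≤ ε) (sym (ℚ.+-inverseʳ (fromℤ i))) (ℚ.<⇒≤ 0<ε)

isInteger-+ : ∀ x y → IsInteger x → IsInteger y → IsInteger (x + y)
isInteger-+ x y (i , p) (j , q) = i ℤ.+ j , integer-+ {x} {y} {i} {j} p q

isInteger-- : ∀ x y → IsInteger x → IsInteger y → IsInteger (x - y)
isInteger-- x y (i , p) (j , q) =
  isInteger-+ x (- y) (i , p) (ℤ.- j , integer-neg {y} {j} q)

isInteger-* : ∀ x y → IsInteger x → IsInteger y → IsInteger (x * y)
isInteger-* x y (i , p) (j , q) = i ℤ.* j , integer-* {x} {y} {i} {j} p q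

normℝ : (m a b c : ℝ) → ℝ
normℝ = norm _+_ _-_ _*_ (integer (+ 4))

isInteger-norm : ∀ m a b c → IsInteger m → IsInteger a → IsInteger b → IsInteger c →
                 IsInteger (normℝ m a b c)
isInteger-norm m a b c im ia ib ic =
  isInteger-- (f * f * a) (e * e) (isInteger-* (f * f) a (isInteger-* f f if if) ia)
                                  (isInteger-* e e ie ie)
  where
  4ℝ = integer (+ 4)
  g  = m * m + a - b - c
  h  = m * m * a - b * c
  e  = g * g + 4ℝ * h
  f  = 4ℝ * m * g
  i4  = isInteger-integer (+ 4)
  imm = isInteger-* m m im im
  ig : IsInteger g
  ig = isInteger-- (m * m + a - b) c
         (isInteger-- (m * m + a) b (isInteger-+ (m * m) a imm ia) ib) ic
  ih : IsInteger h
  ih = isInteger-- (m * m * a) (b * c) (isInteger-* (m * m) a imm ia) (isInteger-* b c ib ic)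
  ie : IsInteger e
  ie = isInteger-+ (g * g) (4ℝ * h) (isInteger-* g g ig ig) (isInteger-* 4ℝ h i4 ih)
  if : IsInteger f
  if = isInteger-* (4ℝ * m) g (isInteger-* 4ℝ m i4 im) ig

-- The lower bound for the distance to one fixed integer.

module _ {n a b c : ℕ} (1≤n : 1 ℕ.≤ n)
         (1≤a : 1 ℕ.≤ a) (a≤n : a ℕ.≤ n) (1≤b : 1 ℕ.≤ b) (b≤n : b ℕ.≤ n)
         (1≤c : 1 ℕ.≤ c) (c≤n : c ℕ.≤ n) (m : ℤ) where

  -- `N` is formed from `√ a * √ a` rather than from the integer a, so that each term of `N` is by
  -- computation the rational norm of the approximations, where `e*cofactor≡norm` applies.
  -- Integrality comes from `√-square`.
  S e N : ℝ
  S = √ a + √ b + √ c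
  e = S - integer m
  N = normℝ (integer m) (√ a * √ a) (√ b * √ b) (√ c * √ c)

  isInteger-N : IsInteger N
  isInteger-N = isInteger-norm (integer m) (√ a * √ a) (√ b * √ b) (√ c * √ c)
    (isInteger-integer m) (+ a , √-square a) (+ b , √-square b) (+ c , √-square c)

  module Term (k : ℕ) (u≤⅛ : 1ℤ ℚ./ suc k ℚ.≤ ⅛) where
    open ℚ.≤-Reasoning
    open +-*-Solver using (solve; _:=_; _:+_; _:*_; con)
    open Conjugates (fromℤ m) (sqrtApprox a k) (sqrtApprox b k) (sqrtApprox c k)
      using (cofactor; cofactor-bounds; e*cofactor≡norm)

    w r ∣e∣ : ℚ
    w   = sqrtApprox n k
    r   = sqrtApprox (n ℕ.^ 7) k
    ∣e∣ = ℚ.∣ seq e k ∣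

    ⅞≤r : ⅞ ℚ.≤ r
    ⅞≤r = sqrtApprox-≥⅞ {n ℕ.^ 7} {k} (ℕ.m^n>0 n {{ℕ.>-nonZero 1≤n}} 7) u≤⅛

    0<r : 0ℚ ℚ.< r
    0<r = ℚ.<-≤-trans (ℚ.positive⁻¹ ⅞) ⅞≤r

    -- Away from the integer no norm is involved: `L * r` is at least 4 · 7/8, so its product with
    -- 1/2 exceeds 1.
    ∣e∣-large : ½ ℚ.≤ ∣e∣ → recip L ℚ.* recip r ℚ.≤ ∣e∣
    ∣e∣-large ½≤e = recip-*-≤ 0<L 0<r (begin
      1ℚ                          ≤⟨ toWitness {a? = 1ℚ ℚ.≤? ½ ℚ.* (fromℤ (+ 4) ℚ.* ⅞)} _ ⟩
      ½ ℚ.* (fromℤ (+ 4) ℚ.* ⅞)   ≤⟨ *-mono-≤-nonNeg (ℚ.<⇒≤ 0<½)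
                                       (ℚ.<⇒≤ (0<p*q 0<L 0<r)) ½≤e
                                       (*-mono-≤-nonNeg (0≤/ 4 0) (ℚ.<⇒≤ 0<r) 4≤L ⅞≤r) ⟩
      ∣e∣ ℚ.* (L ℚ.* r)           ∎)

    module Small (∣e∣≤¾ : ∣e∣ ℚ.≤ ¾) where

      bounds : 1ℚ ℚ.≤ cofactor × cofactor ℚ.≤ (fromℤ (+ 13) ℚ.* w) ^ 7
      bounds = cofactor-bounds ∣e∣≤¾ (⅞≤ 1≤n)
          (⅞≤ 1≤a) (≤2w a≤n) (⅞≤ 1≤b) (≤2w b≤n) (⅞≤ 1≤c) (≤2w c≤n)
        where
        ⅞≤ : ∀ {j} → 1 ℕ.≤ j → ⅞ ℚ.≤ sqrtApprox j k
        ⅞≤ {j} 1≤j = sqrtApprox-≥⅞ {j} {k} 1≤j u≤⅛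
        ≤2w : ∀ {j} → j ℕ.≤ n → sqrtApprox j k ℚ.≤ w ℚ.+ w
        ≤2w {j} j≤n = sqrtApprox-mono {j} {n} {k} j≤n 1≤n u≤⅛

      cofactor≤ : cofactor ℚ.≤ K ℚ.* (r ℚ.+ r)
      cofactor≤ = begin
        cofactor                     ≤⟨ proj₂ bounds ⟩
        (fromℤ (+ 13) ℚ.* w) ^ 7     ≡⟨ ^-distrib-* (fromℤ (+ 13)) w 7 ⟩
        K ℚ.* w ^ 7                  ≤⟨ ℚ.*-monoˡ-≤-nonNeg K {{ℚ.nonNegative (ℚ.<⇒≤ 0<K)}}
                                          (sqrtApprox-^ {n} {k} 7 1≤n u≤⅛) ⟩
        K ℚ.* (r ℚ.+ r)              ∎

      0≤cofactor : 0ℚ ℚ.≤ cofactor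
      0≤cofactor = ℚ.≤-trans 0≤1 (proj₁ bounds)

      ∣N∣≡ : ℚ.∣ seq N k ∣ ≡ ∣e∣ ℚ.* cofactor
      ∣N∣≡ = trans (cong ℚ.∣_∣ (sym e*cofactor≡norm))
        (trans (ℚ.∣p*q∣≡∣p∣*∣q∣ (seq e k) cofactor)
               (cong (∣e∣ ℚ.*_) (ℚ.0≤p⇒∣p∣≡p 0≤cofactor)))

      -- Because the cofactor is at least 1, a vanishing norm forces `e` to vanish.
      ∣e∣≤∣N∣ : ∣e∣ ℚ.≤ ℚ.∣ seq N k ∣
      ∣e∣≤∣N∣ = begin
        ∣e∣                 ≡⟨ ℚ.*-identityʳ ∣e∣ ⟨
        ∣e∣ ℚ.* 1ℚ          ≤⟨ ℚ.*-monoˡ-≤-nonNeg ∣e∣ {{ℚ.nonNegative (ℚ.0≤∣p∣ (seq e k))}}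
                                 (proj₁ bounds) ⟩
        ∣e∣ ℚ.* cofactor    ≡⟨ ∣N∣≡ ⟨
        ℚ.∣ seq N k ∣       ∎

      -- 1 ≤ 2∣N∣ = 2∣e∣ · cofactor ≤ 2∣e∣ · K · 2r = ∣e∣ · L · r.
      ∣e∣-lowerBound : ½ ℚ.≤ ℚ.∣ seq N k ∣ → recip L ℚ.* recip r ℚ.≤ ∣e∣
      ∣e∣-lowerBound ½≤N = recip-*-≤ 0<L 0<r (begin
        1ℚ                                   ≤⟨ ℚ.+-mono-≤ ½≤N ½≤N ⟩
        ℚ.∣ seq N k ∣ ℚ.+ ℚ.∣ seq N k ∣      ≡⟨ cong₂ ℚ._+_ ∣N∣≡ ∣N∣≡ ⟩
        ∣e∣ ℚ.* cofactor ℚ.+ ∣e∣ ℚ.* cofactor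
          ≤⟨ ℚ.+-mono-≤ step step ⟩
        ∣e∣ ℚ.* (K ℚ.* (r ℚ.+ r)) ℚ.+ ∣e∣ ℚ.* (K ℚ.* (r ℚ.+ r))
          ≡⟨ solve 3 (λ e K r → e :* (K :* (r :+ r)) :+ e :* (K :* (r :+ r))
                                := e :* (con (fromℤ (+ 4)) :* K :* r)) refl ∣e∣ K r ⟩
        ∣e∣ ℚ.* (L ℚ.* r)                    ∎)
        where
        step : ∣e∣ ℚ.* cofactor ℚ.≤ ∣e∣ ℚ.* (K ℚ.* (r ℚ.+ r))
        step = ℚ.*-monoˡ-≤-nonNeg ∣e∣ {{ℚ.nonNegative (ℚ.0≤∣p∣ (seq e k))}} cofactor≤

  TermBound : ℕ → Set
  TermBound k = recip L ℚ.* recip (sqrtApprox (n ℕ.^ 7) k) ℚ.≤ ℚ.∣ seq e k ∣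

  -- From single terms to all sufficiently late terms.

  module Tail (M : ℕ) (near : Eventually λ k → ℚ.∣ seq e k ℚ.- seq e M ∣ ℚ.≤ ⅛) where

    fine : Eventually λ k → 1ℤ ℚ./ suc k ℚ.≤ ⅛
    fine = archimedean {⅛} (ℚ.positive⁻¹ ⅛)

    large : ⅝ ℚ.≤ ℚ.∣ seq e M ∣ → Eventually TermBound
    large ⅝≤∣e∣ = both (λ k u≤⅛ e-e≤⅛ → Term.∣e∣-large k u≤⅛
      (∣p∣-lowerBound {seq e k} {seq e M} {½} {⅛} ⅝≤∣e∣ e-e≤⅛)) fine near

    module Small (∣e∣≤⅝ : ℚ.∣ seq e M ∣ ℚ.≤ ⅝) where

      FineAndSmall : ℕ → Set
      FineAndSmall k = Σ[ u≤⅛ ∈ 1ℤ ℚ./ suc k ℚ.≤ ⅛ ] ℚ.∣ seq e k ∣ ℚ.≤ ¾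

      fineAndSmall : Eventually FineAndSmall
      fineAndSmall = both (λ k u≤⅛ e-e≤⅛ →
        u≤⅛ , ℚ.≤-trans (p≤q+∣p-q∣ ℚ.∣ seq e k ∣ ℚ.∣ seq e M ∣)
          (ℚ.+-mono-≤ ∣e∣≤⅝ (ℚ.≤-trans (abs-nonexpansive (seq e k) (seq e M)) e-e≤⅛)))
        fine near

      norm≃0⇒S≃m : N ≃ 0ℝ → S ≃ integer m
      norm≃0⇒S≃m N≃0 ε 0<ε = both (λ k (u≤⅛ , ∣e∣≤¾) N≤ε →
        ℚ.≤-trans (Term.Small.∣e∣≤∣N∣ k u≤⅛ ∣e∣≤¾)
          (subst (λ t → ℚ.∣ t ∣ ℚ.≤ ε) (ℚ.+-identityʳ (seq N k)) N≤ε))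
        fineAndSmall (N≃0 ε 0<ε)

      -- Late terms of `N` are within 1/2 of a nonzero integer, hence at least 1/2 in absolute
      -- value.
      norm≄0⇒bound : ∀ {i} → i ≢ 0ℤ → N ≃ integer i → Eventually TermBound
      norm≄0⇒bound {i} i≢0 N≃i = both (λ k (u≤⅛ , ∣e∣≤¾) N-i≤½ →
        Term.Small.∣e∣-lowerBound k u≤⅛ ∣e∣≤¾
          (∣p∣-lowerBound {seq N k} {fromℤ i} {½} {½} (1≤∣fromℤ∣ i≢0) N-i≤½))
        fineAndSmall (N≃i ½ 0<½)

      bound : ¬ IsInteger S → ∀ i → N ≃ integer i → Dec (i ≡ 0ℤ) → Eventually TermBound
      -- The split is on the integer `i`, whose equality with 0 is decidable. Norm zero would make
      -- `S` equal to `m`, against the hypothesis.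
      bound S∉ℤ _ N≃i (yes refl) = contradiction (m , norm≃0⇒S≃m N≃i) S∉ℤ
      bound S∉ℤ _ N≃i (no i≢0)   = norm≄0⇒bound i≢0 N≃i

    -- The case split tests one rational term, which is decidable, instead of the real `e`. As later
    -- terms differ from it by at most 1/8, the threshold 5/8 gives either at least 1/2 or at most
    -- 3/4 throughout the tail.
    bound : ¬ IsInteger S → Dec (ℚ.∣ seq e M ∣ ℚ.≤ ⅝) → Eventually TermBound
    bound S∉ℤ (yes ∣e∣≤⅝) = let i , N≃i = isInteger-N in
      Small.bound ∣e∣≤⅝ S∉ℤ i N≃i (i ℤ.≟ 0ℤ)
    bound S∉ℤ (no ∣e∣≰⅝)  = large (ℚ.<⇒≤ (ℚ.≰⇒> ∣e∣≰⅝))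

  eventually-bound : ¬ IsInteger S → Eventually TermBound
  eventually-bound S∉ℤ = let M , near = cauchy e ⅛ (ℚ.positive⁻¹ ⅛) in
    Tail.bound M (M , λ k M≤k → near k M M≤k ℕ.≤-refl) S∉ℤ (ℚ.∣ seq e M ∣ ℚ.≤? ⅝)

proposition1 : Σ[ C ∈ ℝ ] (0ℝ < C) ×
    (∀ (n : ℕ) (1≤n : 1 ℕ.≤ n) (a b c : ℕ) →
    1 ℕ.≤ a → a ℕ.≤ n →
    1 ℕ.≤ b → b ℕ.≤ n →
    1 ℕ.≤ c → c ℕ.≤ n →
    ¬ IsInteger (√ a + √ b + √ c) →
    C / n ^⁷ᐟ² [ ^⁷ᐟ²-pos 1≤n ] ≤ ‖ √ a + √ b + √ c ‖)
proposition1 =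
  constant (recip L) ,
  (recip L , recip-pos 0<L , 0 , λ _ _ → ℚ.≤-reflexive (ℚ.+-identityˡ (recip L))) ,
  λ n 1≤n a b c 1≤a a≤n 1≤b b≤n 1≤c c≤n S∉ℤ →
    -- It suffices to bound the distance to each integer `m` separately, so the index from which the
    -- bound holds may depend on `m`; the constant does not.
    ‖‖-greatest (√ a + √ b + √ c) (constant (recip L) / n ^⁷ᐟ² [ ^⁷ᐟ²-pos 1≤n ]) λ m ε 0<ε →
      let M , h = eventually-bound 1≤n 1≤a a≤n 1≤b b≤n 1≤c c≤n m S∉ℤ
      in M , λ k M≤k → ℚ.≤-trans (h k M≤k) (p≤p+q (ℚ.<⇒≤ 0<ε))
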